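{- Let $Ob$ be the universe of objects of an information system, let $R$ be its indiscernibility relation, and for $A \subseteq Ob$ let $\mu_A : Ob \to \{0, 1/2, 1\}$ be the associated membership function. The membership function extends to the operations $\odot$, $\uplus$ and $\neg$ between sets; that is, for all $A, B \subseteq Ob$ and all $x \in Ob$, $$\mu_{A \odot B}(x) = \min(\mu_A(x), \mu_B(x)), \qquad \mu_{A \uplus B}(x) = \max(\mu_A(x), \mu_B(x)), \qquad \mu_{\neg A}(x) = 1 - \mu_A(x).$$
   Context: An information system is a system $(Ob, Att, \{Val_a : a \in Att\}, f)$ where $Ob$ is a nonempty set (the universe of objects), $Att$ is a nonempty finite set of attributes, each $Val_a$ is a nonempty set of values of the attribute $a$, and $f : Ob \times Att \to \bigcup_{a \in Att} Val_a$ is a function with $f(x,a) \in Val_a$ for all $x \in Ob$, $a \in Att$. Its indiscernibility relation $R$ is the equivalence relation on $Ob$ given by: $x R y$ if and only if $f(x,a) = f(y,a)$ for every $a \in Att$. Let $R^{\ast}$ be the set of equivalence classes of $R$. For $A \subseteq Ob$ write $\neg A = Ob \setminus A$ and $$MA = \bigcup \{C \in R^{\ast} : C \cap A \neq \emptyset\}, \qquad LA = \neg M \neg A = \bigcup \{C \in R^{\ast} : C \subseteq A\}.$$ For $A, B \subseteq Ob$ define $$A \odot B = MA \cap B \cap (A \cup M \neg B), \qquad A \uplus B = LA \cup B \cup (A \cap L \neg B).$$ The membership function $\mu_A : Ob \to \{0, 1/2, 1\}$ associated to $A \subseteq Ob$ is defined by: $\mu_A(x) = 1$ iff $x \in LA$;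 $\mu_A(x) = 1/2$ iff $x \in MA \cap \neg LA$; $\mu_A(x) = 0$ iff $x \in \neg MA$. -}

module Defs where

open import Axiom.ExcludedMiddle using (ExcludedMiddle)
open import Data.Empty using (⊥-elim)
open import Data.Fin.Base using (Fin)
open import Data.Nat.Base using (ℕ)
open import Data.Product.Base using (Σ; _,_; proj₁; proj₂; ∃)
open import Data.Rational.Base using (ℚ; 0ℚ; 1ℚ; ½)
open import Function.Bundles using (_⇔_; _↔_; mk⇔; Equivalence)
open import Level using (Level; suc; _⊔_)
open import Relation.Binary.Core using (Rel)
open import Relation.Binary.Structures using (IsEquivalence)
open import Relation.Binary.PropositionalEquality using (_≡_; refl; sym; trans)
open import Relation.Nullary using (yes; no)
open import Relation.Unary
  using (Pred; _∈_; _⊆_; _≐_; _≬_; _∩_; _∪_; ∁; ⋃)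

-- The map f is given as a dependent function, so f x a lies in Val a by typing.
record InformationSystem (o a v : Level) : Set (suc (o ⊔ a ⊔ v)) where
  field
    Ob  : Set o
    Att : Set a
    Val : Att → Set v
    f   : (x : Ob) (p : Att) → Val p

    Ob-nonempty  : Ob
    Att-nonempty : Att
    Att-finite   : ∃ λ (n : ℕ) → Att ↔ Fin n
    Val-nonempty : (p : Att) → Val p

data Degree : Set where
  zero half one : Degree

⟦_⟧ : Degree → ℚ
⟦ zero ⟧ = 0ℚ
⟦ half ⟧ = ½
⟦ one  ⟧ = 1ℚ

module RoughSets {o a v : Level} (S : InformationSystem o a v) where

  open InformationSystem S

  R : Rel Ob (a ⊔ v)
  R x y = ∀ p → f x p ≡ f y p

  R-isEquivalence : IsEquivalence R
  R-isEquivalence = record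
    { refl  = λ _ → refl
    ; sym   = λ r p → sym (r p)
    ; trans = λ r s p → trans (r p) (s p)
    }

  -- The equivalence class of z. Unions over all classes are taken over
  -- representatives z, since every class has this form.
  [_] : Ob → Pred Ob (a ⊔ v)
  [ z ] = R z

  module _ {ℓ : Level} where

    -- C ≬ A says constructively that C ∩ A has an element.
    M : Pred Ob ℓ → Pred Ob (o ⊔ a ⊔ v ⊔ ℓ)
    M A = ⋃ (Σ Ob λ z → [ z ] ≬ A) (λ C → [ proj₁ C ])

    L : Pred Ob ℓ → Pred Ob (o ⊔ a ⊔ v ⊔ ℓ)
    L A = ∁ (M (∁ A))

    -- Classically, L A is the union of the classes contained in A.
    L-classes : ExcludedMiddle ℓ → (A : Pred Ob ℓ) →
                L A ≐ ⋃ (Σ Ob λ z → [ z ] ⊆ A) (λ C → [ proj₁ C ])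
    L-classes em A = to , from
      where
      to : L A ⊆ ⋃ (Σ Ob λ z → [ z ] ⊆ A) (λ C → [ proj₁ C ])
      to {x} x∈LA = (x , class⊆A) , λ _ → refl
        where
        class⊆A : [ x ] ⊆ A
        class⊆A {y} xRy with em {A y}
        ... | yes y∈A = y∈A
        ... | no  y∉A = ⊥-elim (x∈LA ((x , y , xRy , y∉A) , λ _ → refl))

      from : ⋃ (Σ Ob λ z → [ z ] ⊆ A) (λ C → [ proj₁ C ]) ⊆ L A
      from ((z , z⊆A) , zRx) ((w , y , wRy , y∉A) , wRx) =
        y∉A (z⊆A (λ p → trans (zRx p) (trans (sym (wRx p)) (wRy p))))

    infixr 7 _⊙_
    infixr 6 _⊎_

    _⊙_ : Pred Ob ℓ → Pred Ob ℓ → Pred Ob (o ⊔ a ⊔ v ⊔ ℓ)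
    A ⊙ B = M A ∩ B ∩ (A ∪ M (∁ B))

    _⊎_ : Pred Ob ℓ → Pred Ob ℓ → Pred Ob (o ⊔ a ⊔ v ⊔ ℓ)
    A ⊎ B = L A ∪ B ∪ (A ∩ L (∁ B))

    -- μ is the membership function of A. This is a relation between A and μ
    -- because computing μ x amounts to deciding x ∈ L A and x ∈ M A; under
    -- excluded middle every A has a membership function, and it is always
    -- unique (see below).
    record IsMembershipFunction (A : Pred Ob ℓ) (μ : Ob → Degree)
                                : Set (o ⊔ a ⊔ v ⊔ ℓ) where
      field
        one⇔  : ∀ x → μ x ≡ one  ⇔ x ∈ L A
        half⇔ : ∀ x → μ x ≡ half ⇔ x ∈ M A ∩ ∁ (L A)
        zero⇔ : ∀ x → μ x ≡ zero ⇔ x ∈ ∁ (M A)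

    membership-unique : {A : Pred Ob ℓ} {μ ν : Ob → Degree} →
                        IsMembershipFunction A μ → IsMembershipFunction A ν →
                        ∀ x → μ x ≡ ν x
    membership-unique {μ = μ} {ν} isμ isν x = go (μ x) refl
      where
      open Equivalence
      module Mu = IsMembershipFunction isμ
      module Nu = IsMembershipFunction isν

      go : ∀ d → μ x ≡ d → μ x ≡ ν x
      go one  eq = trans eq (sym (from (Nu.one⇔  x) (to (Mu.one⇔  x) eq)))
      go half eq = trans eq (sym (from (Nu.half⇔ x) (to (Mu.half⇔ x) eq)))
      go zero eq = trans eq (sym (from (Nu.zero⇔ x) (to (Mu.zero⇔ x) eq)))

    membership-exists : ExcludedMiddle (o ⊔ a ⊔ v ⊔ ℓ) → (A : Pred Ob ℓ) →
                        ∃ (IsMembershipFunction A)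
    membership-exists em A = μ , record
      { one⇔  = one⇔ ; half⇔ = half⇔ ; zero⇔ = zero⇔ }
      where
      μ : Ob → Degree
      μ x with em {L A x} | em {M A x}
      ... | yes _ | _     = one
      ... | no  _ | yes _ = half
      ... | no  _ | no  _ = zero

      L⊆M : ∀ {x} → x ∈ L A → x ∈ ∁ (∁ (M A))
      L⊆M {x} x∈LA x∉MA = x∈LA ((x , x , (λ _ → refl) , x∉A) , λ _ → refl)
        where
        x∉A : x ∈ ∁ A
        x∉A x∈A = x∉MA ((x , x , (λ _ → refl) , x∈A) , λ _ → refl)

      one⇔ : ∀ x → μ x ≡ one ⇔ x ∈ L A
      one⇔ x with em {L A x} | em {M A x}
      ... | yes l | _     = mk⇔ (λ _ → l) (λ _ → refl)
      ... | no ¬l | yes _ = mk⇔ (λ ()) (λ l → ⊥-elim (¬l l))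
      ... | no ¬l | no  _ = mk⇔ (λ ()) (λ l → ⊥-elim (¬l l))

      half⇔ : ∀ x → μ x ≡ half ⇔ x ∈ M A ∩ ∁ (L A)
      half⇔ x with em {L A x} | em {M A x}
      ... | yes l | _     = mk⇔ (λ ()) (λ h → ⊥-elim (proj₂ h l))
      ... | no ¬l | yes m = mk⇔ (λ _ → m , ¬l) (λ _ → refl)
      ... | no ¬l | no ¬m = mk⇔ (λ ()) (λ h → ⊥-elim (¬m (proj₁ h)))

      zero⇔ : ∀ x → μ x ≡ zero ⇔ x ∈ ∁ (M A)
      zero⇔ x with em {L A x} | em {M A x}
      ... | yes l | _     = mk⇔ (λ ()) (λ ¬m → ⊥-elim (L⊆M l ¬m))
      ... | no _  | yes m = mk⇔ (λ ()) (λ ¬m → ⊥-elim (¬m m))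
      ... | no _  | no ¬m = mk⇔ (λ _ → ¬m) (λ _ → refl)

{-# OPTIONS --safe #-}
-- Classically,
--   L (A ⊙ B) = L A ∩ L B,   M (A ⊙ B) = M A ∩ M B,
--   L (A ⊎ B) = L A ∪ L B,   M (A ⊎ B) = M A ∪ M B,
-- and a degree is determined by whether it is one (x ∈ L A) and whether it is
-- zero (x ∉ M A). Constructively the identities hold up to double negation,
-- which suffices because equality of degrees is decidable.
module Submission where

open import Defs
open import Level using (Level)
open import Data.Empty using (⊥-elim)
open import Data.Product using (_×_; _,_; proj₁; proj₂)
open import Data.Product.Function.NonDependent.Propositional using (_×-⇔_)
open import Data.Rational using (_⊓_; _⊔_; _-_; 1ℚ)
open import Data.Sum.Base using (inj₁; inj₂)
open import Function.Base using (_∘_)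
open import Function.Bundles using (_⇔_; mk⇔; Equivalence)
open import Function.Properties.Equivalence using () renaming (sym to ⇔-sym; trans to ⇔-trans)
open import Function.Related.TypeIsomorphisms using (¬-cong-⇔)
open import Relation.Binary.PropositionalEquality using (_≡_; refl; sym; trans; cong)
open import Relation.Binary.Structures using (IsEquivalence)
open import Relation.Nullary using (¬_; yes; no)
open import Relation.Nullary.Decidable using (¬¬-excluded-middle)
open import Relation.Unary using (Pred; ∁; _∈_; _⊆_; _≬_)

open Equivalence using (to; from)

-- The three-element chain of degrees.

infixr 7 _∧_
infixr 6 _∨_

-- Minimum for the order `zero` < `half` < `one`, kept on `Degree` so that equations follow by
-- finite case analysis; `⟦⟧-∧` carries it to the rationals.
_∧_ : Degree → Degree → Degree
zero ∧ e    = zero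
half ∧ zero = zero
half ∧ half = half
half ∧ one  = half
one  ∧ e    = e

_∨_ : Degree → Degree → Degree
zero ∨ e    = e
half ∨ zero = half
half ∨ half = half
half ∨ one  = one
one  ∨ e    = one

complement : Degree → Degree
complement zero = one
complement half = half
complement one  = zero

⟦⟧-∧ : ∀ d e → ⟦ d ∧ e ⟧ ≡ ⟦ d ⟧ ⊓ ⟦ e ⟧
⟦⟧-∧ zero zero = refl
⟦⟧-∧ zero half = refl
⟦⟧-∧ zero one  = refl
⟦⟧-∧ half zero = refl
⟦⟧-∧ half half = refl
⟦⟧-∧ half one  = refl
⟦⟧-∧ one  zero = refl
⟦⟧-∧ one  half = refl
⟦⟧-∧ one  one  = refl

⟦⟧-∨ : ∀ d e → ⟦ d ∨ e ⟧ ≡ ⟦ d ⟧ ⊔ ⟦ e ⟧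
⟦⟧-∨ zero zero = refl
⟦⟧-∨ zero half = refl
⟦⟧-∨ zero one  = refl
⟦⟧-∨ half zero = refl
⟦⟧-∨ half half = refl
⟦⟧-∨ half one  = refl
⟦⟧-∨ one  zero = refl
⟦⟧-∨ one  half = refl
⟦⟧-∨ one  one  = refl

⟦⟧-complement : ∀ d → ⟦ complement d ⟧ ≡ 1ℚ - ⟦ d ⟧
⟦⟧-complement zero = refl
⟦⟧-complement half = refl
⟦⟧-complement one  = refl

degree-ext : ∀ d e → d ≡ one ⇔ e ≡ one → d ≡ zero ⇔ e ≡ zero → d ≡ e
degree-ext zero e    _  d0 = sym (to d0 refl)
degree-ext one  e    d1 _  = sym (to d1 refl)
degree-ext half zero _  d0 = from d0 refl
degree-ext half half _  _  = refl
degree-ext half one  d1 _  = from d1 refl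

∧≡one⇔ : ∀ d e → d ∧ e ≡ one ⇔ (d ≡ one × e ≡ one)
∧≡one⇔ zero e    = mk⇔ (λ ()) (λ ())
∧≡one⇔ half zero = mk⇔ (λ ()) (λ ())
∧≡one⇔ half half = mk⇔ (λ ()) (λ ())
∧≡one⇔ half one  = mk⇔ (λ ()) (λ ())
∧≡one⇔ one  e    = mk⇔ (refl ,_) proj₂

-- The disjunction is written in de Morgan form to match `∁M-⊙`, where only this weaker form is
-- derived.
∧≡zero⇔ : ∀ d e → d ∧ e ≡ zero ⇔ (¬ (¬ d ≡ zero × ¬ e ≡ zero))
∧≡zero⇔ zero e    = mk⇔ (λ _ n → proj₁ n refl) (λ _ → refl)
∧≡zero⇔ half zero = mk⇔ (λ _ n → proj₂ n refl) (λ _ → refl)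
∧≡zero⇔ half half = mk⇔ (λ ()) (λ n → ⊥-elim (n ((λ ()) , λ ())))
∧≡zero⇔ half one  = mk⇔ (λ ()) (λ n → ⊥-elim (n ((λ ()) , λ ())))
∧≡zero⇔ one  zero = mk⇔ (λ _ n → proj₂ n refl) (λ _ → refl)
∧≡zero⇔ one  half = mk⇔ (λ ()) (λ n → ⊥-elim (n ((λ ()) , λ ())))
∧≡zero⇔ one  one  = mk⇔ (λ ()) (λ n → ⊥-elim (n ((λ ()) , λ ())))

complement≡one⇔ : ∀ d → complement d ≡ one ⇔ d ≡ zero
complement≡one⇔ zero = mk⇔ (λ _ → refl) (λ _ → refl)
complement≡one⇔ half = mk⇔ (λ ()) (λ ())
complement≡one⇔ one  = mk⇔ (λ ()) (λ ())

complement≡zero⇔ : ∀ d → complement d ≡ zero ⇔ d ≡ one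
complement≡zero⇔ zero = mk⇔ (λ ()) (λ ())
complement≡zero⇔ half = mk⇔ (λ ()) (λ ())
complement≡zero⇔ one  = mk⇔ (λ _ → refl) (λ _ → refl)

∨≡one⇔ : ∀ d e → d ∨ e ≡ one ⇔ (¬ (¬ d ≡ one × ¬ e ≡ one))
∨≡one⇔ one  e    = mk⇔ (λ _ n → proj₁ n refl) (λ _ → refl)
∨≡one⇔ half one  = mk⇔ (λ _ n → proj₂ n refl) (λ _ → refl)
∨≡one⇔ half half = mk⇔ (λ ()) (λ n → ⊥-elim (n ((λ ()) , λ ())))
∨≡one⇔ half zero = mk⇔ (λ ()) (λ n → ⊥-elim (n ((λ ()) , λ ())))
∨≡one⇔ zero one  = mk⇔ (λ _ n → proj₂ n refl) (λ _ → refl)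
∨≡one⇔ zero half = mk⇔ (λ ()) (λ n → ⊥-elim (n ((λ ()) , λ ())))
∨≡one⇔ zero zero = mk⇔ (λ ()) (λ n → ⊥-elim (n ((λ ()) , λ ())))

∨≡zero⇔ : ∀ d e → d ∨ e ≡ zero ⇔ (d ≡ zero × e ≡ zero)
∨≡zero⇔ one  e    = mk⇔ (λ ()) (λ ())
∨≡zero⇔ half one  = mk⇔ (λ ()) (λ ())
∨≡zero⇔ half half = mk⇔ (λ ()) (λ ())
∨≡zero⇔ half zero = mk⇔ (λ ()) (λ ())
∨≡zero⇔ zero e    = mk⇔ (refl ,_) proj₂

-- Lower and upper approximations.

module Approximations {o a v : Level} (S : InformationSystem o a v) where

  open InformationSystem S
  open RoughSets S
  module R = IsEquivalence R-isEquivalence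

  private variable
    ℓ   : Level
    A B : Pred Ob ℓ
    x y : Ob

  M⁺ : R x y → y ∈ A → x ∈ M A
  M⁺ {x = x} {y = y} xRy y∈A = (x , y , xRy , y∈A) , R.refl

  -- Any class containing `x` can be represented by `x` itself.
  M⁻ : x ∈ M A → [ x ] ≬ A
  M⁻ ((z , y , zRy , y∈A) , zRx) = y , R.trans (R.sym zRx) zRy , y∈A

  -- `L A` is itself a negation, so without excluded middle it controls membership in `A` only up to
  -- double negation.
  L⁺ : [ x ] ⊆ ∁ (∁ A) → x ∈ L A
  L⁺ x⊆A x∈M∁A with y , xRy , y∉A ← M⁻ x∈M∁A = x⊆A xRy y∉A

  L⁻ : x ∈ L A → [ x ] ⊆ ∁ (∁ A)
  L⁻ x∈LA xRy y∉A = x∈LA (M⁺ xRy y∉A)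

  M-resp-R : R x y → x ∈ M A → y ∈ M A
  M-resp-R xRy (C , zRx) = C , R.trans zRx xRy

  L-resp-R : R x y → x ∈ L A → y ∈ L A
  L-resp-R xRy x∈LA = x∈LA ∘ M-resp-R (R.sym xRy)

  L⊆¬¬M : L A ⊆ ∁ (∁ (M A))
  L⊆¬¬M x∈LA x∉MA = L⁻ x∈LA R.refl (x∉MA ∘ M⁺ R.refl)

  -- Unfolding `L (∁ A)` puts three negations on `A`, and these collapse to one.
  L∁⇔∁M : (A : Pred Ob ℓ) → x ∈ L (∁ A) ⇔ x ∈ ∁ (M A)
  L∁⇔∁M A = mk⇔
    (λ l m → let _ , xRy , y∈A = M⁻ m in L⁻ l xRy (λ y∉A → y∉A y∈A))
    (λ ¬m → L⁺ λ xRy ¬y∉A → ¬y∉A (¬m ∘ M⁺ xRy))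

  module _ (A B : Pred Ob ℓ) where

    -- The factor `B` forces the class into `B`. The class then misses `∁ B`, so the factor
    -- `A ∪ M (∁ B)` forces it into `A`.
    L-⊙ : x ∈ L (A ⊙ B) ⇔ (x ∈ L A × x ∈ L B)
    L-⊙ {x = x} = mk⇔ (λ l → l-A l , l-B l) λ (lA , lB) → L⁺ λ xRy n →
      L⁻ lA xRy λ y∈A → L⁻ lB xRy λ y∈B → n (M⁺ R.refl y∈A , y∈B , inj₁ y∈A)
      where
      l-B : x ∈ L (A ⊙ B) → x ∈ L B
      l-B l = L⁺ λ xRy y∉B → L⁻ l xRy λ (_ , y∈B , _) → y∉B y∈B

      l-A : x ∈ L (A ⊙ B) → x ∈ L A
      l-A l = L⁺ λ xRy y∉A → L⁻ l xRy λ where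
        (_ , _ , inj₁ y∈A)   → y∉A y∈A
        (_ , _ , inj₂ y∈M∁B) → l-B l (M-resp-R (R.sym xRy) y∈M∁B)

    -- A class missing `A ⊙ B` does not reveal which of `A` and `B` it misses, hence the de Morgan
    -- form. The goal is negative, so `meet` may split cases under double negation.
    ∁M-⊙ : x ∈ ∁ (M (A ⊙ B)) ⇔ (¬ (¬ x ∈ ∁ (M A) × ¬ x ∈ ∁ (M B)))
    ∁M-⊙ {x = x} = mk⇔
      (λ ¬m (nA , nB) → nA λ mA → nB λ mB → meet mA mB ¬m)
      (λ n m → let _ , xRy , (mA , y∈B , _) = M⁻ {A = A ⊙ B} m in
        n ((λ ¬mA → ¬mA (M-resp-R (R.sym xRy) mA)) , λ ¬mB → ¬mB (M⁺ xRy y∈B)))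
      where
      -- If the class meets ∁ B, a witness of B lies in A ⊙ B; otherwise a
      -- witness of A does.
      meet : x ∈ M A → x ∈ M B → ¬ ¬ x ∈ M (A ⊙ B)
      meet mA mB ¬m = ¬¬-excluded-middle λ where
        (yes m∁B) → let _ , xRy , y∈B = M⁻ mB in
          ¬m (M⁺ xRy (M-resp-R xRy mA , y∈B , inj₂ (M-resp-R xRy m∁B)))
        (no lB) → let _ , xRy , y∈A = M⁻ mA in
          L⁻ lB xRy λ y∈B → ¬m (M⁺ xRy (M-resp-R xRy mA , y∈B , inj₁ y∈A))

    -- If the class is not inside `A`, its points can enter `A ⊎ B` only through `B`: a point of
    -- `L A` would put the whole class in `A`, and so would a point of `L (∁ B)`, by `L∁B⇒LA`.
    L-⊎ : x ∈ L (A ⊎ B) ⇔ (¬ (¬ x ∈ L A × ¬ x ∈ L B))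
    L-⊎ {x = x} = mk⇔
      (λ l (¬lA , ¬lB) → ¬lB (L⁺ λ xRy y∉B → L⁻ l xRy λ where
        (inj₁ lA)               → ¬lA (L-resp-R (R.sym xRy) lA)
        (inj₂ (inj₁ y∈B))       → y∉B y∈B
        (inj₂ (inj₂ (_ , l∁B))) → ¬lA (L∁B⇒LA l (L-resp-R (R.sym xRy) l∁B))))
      (λ n → L⁺ λ xRy ¬y → n
        ( (λ lA → ¬y (inj₁ (L-resp-R xRy lA)))
        , (λ lB → L⁻ lB xRy λ y∈B → ¬y (inj₂ (inj₁ y∈B)))))
      where
      L∁B⇒LA : x ∈ L (A ⊎ B) → x ∈ L (∁ B) → x ∈ L A
      L∁B⇒LA l l∁B = L⁺ λ xRy y∉A → L⁻ l xRy λ where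
        (inj₁ lA)               → L⁻ lA R.refl y∉A
        (inj₂ (inj₁ y∈B))       → to (L∁⇔∁M B) l∁B (M⁺ xRy y∈B)
        (inj₂ (inj₂ (y∈A , _))) → y∉A y∈A

    ∁M-⊎ : x ∈ ∁ (M (A ⊎ B)) ⇔ (x ∈ ∁ (M A) × x ∈ ∁ (M B))
    ∁M-⊎ {x = x} = mk⇔
      (λ ¬m → ¬mA ¬m , ¬mB ¬m)
      (λ (¬mA , ¬mB) m → let _ , xRy , y∈ = M⁻ {A = A ⊎ B} m in avoid ¬mA ¬mB xRy y∈)
      where
      ¬mB : x ∈ ∁ (M (A ⊎ B)) → x ∈ ∁ (M B)
      ¬mB ¬m mB = let _ , xRy , y∈B = M⁻ mB in ¬m (M⁺ xRy (inj₂ (inj₁ y∈B)))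

      ¬mA : x ∈ ∁ (M (A ⊎ B)) → x ∈ ∁ (M A)
      ¬mA ¬m mA = let _ , xRy , y∈A = M⁻ mA in
        -- By `¬mB` the class misses `B`, hence lies in `L (∁ B)`, which puts the witness of `A`
        -- into the third disjunct.
        ¬m (M⁺ xRy (inj₂ (inj₂ (y∈A , L-resp-R xRy (from (L∁⇔∁M B) (¬mB ¬m))))))

      avoid : x ∈ ∁ (M A) → x ∈ ∁ (M B) → R x y → ¬ y ∈ A ⊎ B
      avoid ¬mA ¬mB xRy (inj₁ lA)               = L⊆¬¬M lA (¬mA ∘ M-resp-R (R.sym xRy))
      avoid ¬mA ¬mB xRy (inj₂ (inj₁ y∈B))       = ¬mB (M⁺ xRy y∈B)
      avoid ¬mA ¬mB xRy (inj₂ (inj₂ (y∈A , _))) = ¬mA (M⁺ xRy y∈A)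

proposition4p1 :
    {o a v ℓ : Level} (S : InformationSystem o a v) →
    let open InformationSystem S
        open RoughSets S
    in
    (A B : Pred Ob ℓ) (μA μB : Ob → Degree) →
    IsMembershipFunction A μA → IsMembershipFunction B μB →
    ((μ : Ob → Degree) → IsMembershipFunction (A ⊙ B) μ →
       ∀ x → ⟦ μ x ⟧ ≡ ⟦ μA x ⟧ ⊓ ⟦ μB x ⟧)
    × ((μ : Ob → Degree) → IsMembershipFunction (A ⊎ B) μ →
       ∀ x → ⟦ μ x ⟧ ≡ ⟦ μA x ⟧ ⊔ ⟦ μB x ⟧)
    × ((μ : Ob → Degree) → IsMembershipFunction (∁ A) μ →
       ∀ x → ⟦ μ x ⟧ ≡ 1ℚ - ⟦ μA x ⟧)
proposition4p1 S A B μA μB isA isB =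
    (λ μ isμ x → trans (cong ⟦_⟧ (min μ isμ x)) (⟦⟧-∧ (μA x) (μB x)))
  , (λ μ isμ x → trans (cong ⟦_⟧ (max μ isμ x)) (⟦⟧-∨ (μA x) (μB x)))
  , (λ μ isμ x → trans (cong ⟦_⟧ (neg μ isμ x)) (⟦⟧-complement (μA x)))
  where
  open InformationSystem S
  open RoughSets S
  open Approximations S
  open IsMembershipFunction

  infixr 2 _⟫_
  _⟫_ : ∀ {p q r} {P : Set p} {Q : Set q} {R : Set r} → P ⇔ Q → Q ⇔ R → P ⇔ R
  _⟫_ = ⇔-trans

  min : ∀ μ → IsMembershipFunction (A ⊙ B) μ → ∀ x → μ x ≡ μA x ∧ μB x
  min μ isμ x = degree-ext _ _
    (one⇔ isμ x ⟫ L-⊙ A B ⟫ ⇔-sym (one⇔ isA x ×-⇔ one⇔ isB x)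
      ⟫ ⇔-sym (∧≡one⇔ (μA x) (μB x)))
    (zero⇔ isμ x ⟫ ∁M-⊙ A B
      ⟫ ⇔-sym (¬-cong-⇔ (¬-cong-⇔ (zero⇔ isA x) ×-⇔ ¬-cong-⇔ (zero⇔ isB x)))
      ⟫ ⇔-sym (∧≡zero⇔ (μA x) (μB x)))

  max : ∀ μ → IsMembershipFunction (A ⊎ B) μ → ∀ x → μ x ≡ μA x ∨ μB x
  max μ isμ x = degree-ext _ _
    (one⇔ isμ x ⟫ L-⊎ A B
      ⟫ ⇔-sym (¬-cong-⇔ (¬-cong-⇔ (one⇔ isA x) ×-⇔ ¬-cong-⇔ (one⇔ isB x)))
      ⟫ ⇔-sym (∨≡one⇔ (μA x) (μB x)))
    (zero⇔ isμ x ⟫ ∁M-⊎ A B ⟫ ⇔-sym (zero⇔ isA x ×-⇔ zero⇔ isB x)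
      ⟫ ⇔-sym (∨≡zero⇔ (μA x) (μB x)))

  neg : ∀ μ → IsMembershipFunction (∁ A) μ → ∀ x → μ x ≡ complement (μA x)
  neg μ isμ x = degree-ext _ _
    (one⇔ isμ x ⟫ L∁⇔∁M A ⟫ ⇔-sym (zero⇔ isA x) ⟫ ⇔-sym (complement≡one⇔ (μA x)))
    -- `∁ (M (∁ A))` is `L A` by definition, so the two equivalences compose directly.
    (zero⇔ isμ x ⟫ ⇔-sym (one⇔ isA x) ⟫ ⇔-sym (complement≡zero⇔ (μA x)))
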